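{- Let $p\ge 2$ be an integer, let $j\in\{0,1,\dots,p^p-1\}$, let $A\in\{1,2,\dots,p-1\}$ and $B\in\{0,1,\dots,p-1\}$, and put $T=IVT^{p,1}_j:\mathbb{N}_0\to\mathbb{N}_0$. If the Type-I affine discrete dynamical system $Y_{t+1}=A\,T(Y_t)+B$ is Collatz-like with attractor $\hat A$, then the Type-II affine discrete dynamical system $y_{t+1}=T(A\,y_t+B)$ (with the same $j$, $A$, $B$) is Collatz-like with attractor $(\hat A-B)/A$. In other words, the set of Collatz-like systems of Type I is, with respect to the index $j$ of the underlying map, a subset of the set of Collatz-like systems of Type II.
   Context: $\mathbb{N}_0=\mathbb{N}\cup\{0\}$. For an integer $p\ge 2$ and $0\le j<p^p$, let $f_j:\{0,\dots,p-1\}\to\{0,\dots,p-1\}$ be the function determined by $j=\sum_{i=0}^{p-1} f_j(i)\,p^{i}$; as $j$ varies this enumerates all $p^p$ functions from $\{0,\dots,p-1\}$ to itself. Integral Value Transformation: $IVT^{p,1}_j:\mathbb{N}_0\to\mathbb{N}_0$ is obtained by applying $f_j$ to each base-$p$ digit. If $x=(d_1d_2\dots d_n)_p$ is the usual base-$p$ representation of $x$ (no leading zeros; the number $0$ is represented by the single digit $0$), then $IVT^{p,1}_j(x)$ is the integer whose base-$p$ digit string is $f_j(d_1)f_j(d_2)\dots f_j(d_n)$ (leading zeros in the result being ignored when it is read as an integer). Affine discrete dynamical systems (ADDS), with $A\in\{1,\dots,p-1\}$, $B\in\{0,\dots,p-1\}$: Type I is the iteration on $\mathbb{N}_0$ given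 by $Y_{t+1}=A\,IVT^{p,1}_j(Y_t)+B$; Type II is the iteration on $\mathbb{N}_0$ given by $y_{t+1}=IVT^{p,1}_j(A\,y_t+B)$. Collatz-like: a map $F:\mathbb{N}_0\to\mathbb{N}_0$ (and the dynamical system obtained by iterating $F$) is called Collatz-like with attractor $c\in\mathbb{N}_0$ if $c$ is a fixed value, independent of the starting point, such that for every $n\in\mathbb{N}_0$ there is $m\in\mathbb{N}_0$ with $F^m(n)=c$, where $F^m$ is the $m$-fold iterate. (It is not required that $F(c)=c$; the orbit may stay at $c$ or return to it periodically.) -}

module Defs where

open import Data.Digit using (Digit; fromDigits; toDigits)
open import Data.Fin.Base using (Fin; zero; suc; toℕ)
open import Data.Fin.Properties using (toℕ-fromℕ<; toℕ<n)
open import Data.List.Base using (map)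
open import Data.Nat.Base
open import Data.Nat.DivMod
open import Data.Nat.Properties
open import Data.Product.Base using (∃-syntax; proj₁)
open import Algebra.Properties.Semiring.Sum +-*-semiring
  using (sum; sum-cong-≋; *-distribʳ-sum)
import Function.Endo.Propositional ℕ as Endo
open import Relation.Binary.PropositionalEquality
open import Relation.Nullary.Decidable using (fromWitness)

-- f_j(i) is the coefficient of p^i in the base-p expansion of j; see
-- rule-expansion below.
rule : (p : ℕ) .{{_ : NonZero p}} → Fin (p ^ p) → Digit p → Digit p
rule p j i = ((toℕ j / p ^ toℕ i) {{m^n≢0 p (toℕ i)}}) mod p

-- toDigits returns the usual representation (least significant digit first):
-- no leading zeros, except that 0 is represented by the single digit 0.
IVT : (p : ℕ) .{{_ : NonTrivial p}} → Fin (p ^ p) → ℕ → ℕ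
IVT p j x =
  fromDigits (map (rule p {{nonTrivial⇒nonZero p}} j)
                  (proj₁ (toDigits p {fromWitness (nonTrivial⇒n>1 p)} x)))

typeI : (p : ℕ) .{{_ : NonTrivial p}} (A B : ℕ) → Fin (p ^ p) → ℕ → ℕ
typeI p A B j y = A * IVT p j y + B

typeII : (p : ℕ) .{{_ : NonTrivial p}} (A B : ℕ) → Fin (p ^ p) → ℕ → ℕ
typeII p A B j y = IVT p j (A * y + B)

-- The number m of iterations may be 0, and c need not be a fixed point of F.
CollatzLike : (ℕ → ℕ) → ℕ → Set
CollatzLike F c = ∀ n → ∃[ m ] (F Endo.^ m) n ≡ c

private
  expansion : ∀ p .{{_ : NonZero p}} n k → k < p ^ n →
    sum {n} (λ i → (_/_ k (p ^ toℕ i) {{m^n≢0 p (toℕ i)}} % p) * p ^ toℕ i) ≡ k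
  expansion p zero    zero    _ = refl
  expansion p zero    (suc _) (s≤s ())
  expansion p (suc n) k k<p^n = begin
    (k / 1 % p) * 1 + sum {n} (λ i → d (suc (toℕ i)) * p ^ suc (toℕ i))
      ≡⟨ cong₂ _+_ (trans (*-identityʳ _) (cong (_% p) (n/1≡n k)))
                   (sum-cong-≋ {n} shift) ⟩
    k % p + sum {n} (λ i → (d′ (toℕ i) * p ^ toℕ i) * p)
      ≡⟨ cong (k % p +_) (*-distribʳ-sum {n} p (λ i → d′ (toℕ i) * p ^ toℕ i)) ⟨
    k % p + sum {n} (λ i → d′ (toℕ i) * p ^ toℕ i) * p
      ≡⟨ cong (λ s → k % p + s * p) (expansion p n (k / p) k/p<p^n) ⟩
    k % p + k / p * p
      ≡⟨ m≡m%n+[m/n]*n k p ⟨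
    k ∎
    where
    open ≡-Reasoning
    d d′ : ℕ → ℕ
    d  i = _/_ k       (p ^ i) {{m^n≢0 p i}} % p
    d′ i = _/_ (k / p) (p ^ i) {{m^n≢0 p i}} % p

    k/p<p^n : k / p < p ^ n
    k/p<p^n = m<n*o⇒m/o<n (subst (k <_) (*-comm p (p ^ n)) k<p^n)

    shift : ∀ (i : Fin n) →
      d (suc (toℕ i)) * p ^ suc (toℕ i) ≡ (d′ (toℕ i) * p ^ toℕ i) * p
    shift i = begin
      d (suc e) * (p * p ^ e)  ≡⟨ cong₂ _*_ (cong (_% p) (sym quot)) (*-comm p (p ^ e)) ⟩
      d′ e * (p ^ e * p)       ≡⟨ *-assoc (d′ e) (p ^ e) p ⟨
      (d′ e * p ^ e) * p       ∎
      where
      e = toℕ i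
      quot : _/_ (k / p) (p ^ e) {{m^n≢0 p e}} ≡ _/_ k (p ^ suc e) {{m^n≢0 p (suc e)}}
      quot = m/n/o≡m/[n*o] k p (p ^ e) {{_}} {{m^n≢0 p e}} {{m^n≢0 p (suc e)}}

rule-expansion : ∀ p .{{_ : NonZero p}} (j : Fin (p ^ p)) →
  sum {p} (λ i → toℕ (rule p j i) * p ^ toℕ i) ≡ toℕ j
rule-expansion p j = trans
  (sum-cong-≋ {p} (λ i → cong (_* p ^ toℕ i) (toℕ-fromℕ<
    (m%n<n (_/_ (toℕ j) (p ^ toℕ i) {{m^n≢0 p (toℕ i)}}) p))))
  (expansion p p (toℕ j) (toℕ<n j))

-- In base 2, j = 1 swaps the digits: 0 ↦ 1, and 5 = (101)₂ ↦ (010)₂ = 2.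
_ : IVT 2 (suc zero) 0 ≡ 1
_ = refl

_ : IVT 2 (suc zero) 5 ≡ 2
_ = refl

{-# OPTIONS --safe #-}
-- Write g y = A y + B. Then Type I is F = g ∘ T, Type II is G = T ∘ g, and g semiconjugates
-- G to F: g ∘ Gᵐ = Fᵐ ∘ g. If the F-orbit of g n reaches Â after m steps, then
-- Â = A Gᵐ(n) + B, which forces Gᵐ(n) = (Â − B) / A.
module Submission where

open import Defs
open import Data.Fin.Base using (Fin)
open import Data.Nat.Base using (ℕ; zero; suc; NonZero; NonTrivial; _+_; _*_; _≤_; _<_; _∸_; _/_; _^_)
open import Data.Nat.Divisibility using (_∣_; m∣m*n)
open import Data.Nat.DivMod using (m*n/n≡m)
open import Data.Nat.Properties using (*-comm; m≤n+m; m+n∸n≡m)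
open import Data.Product.Base using (_×_; ∃; _,_; proj₂)
import Function.Endo.Propositional ℕ as Endo
open import Function.Base using (_∘_)
open import Relation.Binary.PropositionalEquality using (_≡_; _≗_; refl; sym; trans; cong; subst)
open import Relation.Unary using (_⊆_)

^-semiconjugate : (F G g : ℕ → ℕ) → g ∘ G ≗ F ∘ g →
  ∀ m → g ∘ (G Endo.^ m) ≗ (F Endo.^ m) ∘ g
^-semiconjugate F G g gG≗Fg zero    n = refl
^-semiconjugate F G g gG≗Fg (suc m) n =
  trans (gG≗Fg ((G Endo.^ m) n)) (cong F (^-semiconjugate F G g gG≗Fg m n))

-- Since `∸` truncates and `/` rounds down, the first two components are what make `(c ∸ B) / A` the
-- exact rational value.
affine-preimage : ∀ A .{{_ : NonZero A}} B {c} y → A * y + B ≡ c →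
  B ≤ c × A ∣ (c ∸ B) × y ≡ (c ∸ B) / A
affine-preimage A B y refl =
    m≤n+m B (A * y)
  , subst (A ∣_) (sym Ay+B∸B≡Ay) (m∣m*n y)
  , sym (trans (cong (_/ A) (trans Ay+B∸B≡Ay (*-comm A y))) (m*n/n≡m y A))
  where
  Ay+B∸B≡Ay : A * y + B ∸ B ≡ A * y
  Ay+B∸B≡Ay = m+n∸n≡m (A * y) B

theorem5p1 : (p : ℕ) .{{_ : NonTrivial p}}
    (A : ℕ) .{{_ : NonZero A}} → A < p →
    (B : ℕ) → B < p →
    ((j : Fin (p ^ p)) (Â : ℕ) →
    CollatzLike (typeI p A B j) Â →
    B ≤ Â × A ∣ (Â ∸ B) × CollatzLike (typeII p A B j) ((Â ∸ B) / A))
    ×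
    ((λ (j : Fin (p ^ p)) → ∃ (CollatzLike (typeI p A B j)))
    ⊆ (λ j → ∃ (CollatzLike (typeII p A B j))))
theorem5p1 p A _ B _ = attractor , λ {j} (Â , collatz) → _ , proj₂ (proj₂ (attractor j Â collatz))
  where
  attractor : (j : Fin (p ^ p)) (Â : ℕ) → CollatzLike (typeI p A B j) Â →
    B ≤ Â × A ∣ (Â ∸ B) × CollatzLike (typeII p A B j) ((Â ∸ B) / A)
  attractor j Â collatz =
    -- These two facts do not mention the starting point, so any one orbit yields them; 0 is an
    -- arbitrary choice.
    let _ , B≤Â , A∣Â∸B , _ = preimage 0 in
    B≤Â , A∣Â∸B , λ n → let m , _ , _ , eq = preimage n in m , eq
    where
    preimage : ∀ n → ∃ λ m →
      B ≤ Â × A ∣ (Â ∸ B) × (typeII p A B j Endo.^ m) n ≡ (Â ∸ B) / A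
    preimage n = let m , Fᵐgn≡Â = collatz (A * n + B) in
      m , affine-preimage A B _ (trans
        -- Both composites unfold to `A * IVT p j (A * y + B) + B`, so the semiconjugacy holds by
        -- `refl`, whatever the digit rule is.
        (^-semiconjugate (typeI p A B j) (typeII p A B j) (λ y → A * y + B) (λ _ → refl) m n)
        Fᵐgn≡Â)
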